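{- For all integers $r\geq2$ and $n\ge0$, there is a bijection between $\mathcal{D}_{r,r-1}(n)$ and $\mathcal{A}_{r,r-1}(n)$.
   Context: A partition $\lambda=(\lambda_1,\dots,\lambda_s)$ is a non-increasing finite sequence of positive integers. For a (possibly empty) partition $\mu=(\mu_1,\dots,\mu_t)$ let $\mathrm{sq}(\mu)=\max\{d\ge0:d\le t,\ \mu_d\ge d\}$ (Durfee square side), $\mathrm{rect}(\mu)=\max\{h\ge0:h\le t,\ \mu_h\ge h+1\}$ (height of the horizontal Durfee rectangle with $h$ rows, $h+1$ columns), and, for nonempty $\mu$, $\mathrm{vrect}(\mu)=\max\{k\ge1:k\le t,\ \mu_k\ge k-1\}$ (height of the vertical Durfee rectangle, the largest rectangle with $k$ rows and $k-1$ columns in the top-left corner; $\mathrm{vrect}(\emptyset)=0$). $\mathcal{D}_{r,r-1}(n)$: partitions $\lambda$ of $n$ such that, with $\mu^{(0)}=\lambda$, $\mu^{(1)}$ equal to $\lambda$ with its first $\mathrm{rect}(\lambda)$ parts deleted, and $\mu^{(j)}$ ($j\ge2$) equal to $\mu^{(j-1)}$ with its first $\mathrm{sq}(\mu^{(j-1)})$ parts deleted, $\mu^{(r-1)}$ is empty. $\mathcal{A}_{r,r-1}(n)$: partitions $\lambda$ of $n$ such that, with $\rho^{(0)}=\lambda$, $\rho^{(j)}$ equal to $\rho^{(j-1)}$ with its first $\mathrm{sq}(\rho^{(j-1)})$ parts deleted for $1\le j\le r-2$, and $\rho^{(r-1)}$ equal to $\rho^{(r-2)}$ with its first $k=\mathrm{vrect}(\rho^{(r-2)})$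 parts deleted, (a) $\rho^{(r-1)}$ is empty, and (b) if $\rho^{(r-2)}$ is nonempty, then its $k$-th part (the last row of the vertical Durfee rectangle) equals $k-1$, i.e. it is a part of the partition of length exactly the width of the rectangle. -}

module Defs where

open import Data.Bool using (Bool; true; false; if_then_else_; _∧_; not; T)
open import Data.Nat using (ℕ; zero; suc; _∸_; _≤ᵇ_; _≡ᵇ_)
open import Data.List using (List; []; _∷_; length; drop; null)
open import Data.Nat.ListAction using (sum)
open import Data.Product using (Σ; _×_)

positive : List ℕ → Bool
positive []       = true
positive (x ∷ xs) = not (x ≡ᵇ 0) ∧ positive xs

nonIncreasing : List ℕ → Bool
nonIncreasing []           = true
nonIncreasing (x ∷ [])     = true
nonIncreasing (x ∷ y ∷ xs) = (y ≤ᵇ x) ∧ nonIncreasing (y ∷ xs)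

isPartitionOf : ℕ → List ℕ → Bool
isPartitionOf n l = positive l ∧ nonIncreasing l ∧ (sum l ≡ᵇ n)

-- 1-based part access: part μ i = μ_i  (only used for 1 ≤ i ≤ length μ)
part : List ℕ → ℕ → ℕ
part []       _             = 0
part (x ∷ xs) zero          = 0
part (x ∷ xs) (suc zero)    = x
part (x ∷ xs) (suc (suc i)) = part xs (suc i)

maxUpTo : (ℕ → Bool) → ℕ → ℕ
maxUpTo p zero    = zero
maxUpTo p (suc t) = if p (suc t) then suc t else maxUpTo p t

sq : List ℕ → ℕ
sq μ = maxUpTo (λ d → d ≤ᵇ part μ d) (length μ)

rect : List ℕ → ℕ
rect μ = maxUpTo (λ h → suc h ≤ᵇ part μ h) (length μ)

-- vertical Durfee rectangle: max { k ≥ 1 : k ≤ t, μ_k ≥ k - 1 }, and 0 for ∅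
-- (for nonempty μ the value k = 1 always qualifies, so the result is ≥ 1)
vrect : List ℕ → ℕ
vrect μ = maxUpTo (λ k → (k ∸ 1) ≤ᵇ part μ k) (length μ)

sqStep : List ℕ → List ℕ
sqStep μ = drop (sq μ) μ

iterate : ℕ → (List ℕ → List ℕ) → List ℕ → List ℕ
iterate zero    f x = x
iterate (suc j) f x = iterate j f (f x)

-- membership condition for D_{r,r-1}: μ^(r-1) is empty, where
-- μ^(1) = drop rect(λ), μ^(j) = sqStep μ^(j-1) for j ≥ 2  (r ≥ 2 assumed)
inD : ℕ → List ℕ → Bool
inD r l = null (iterate (r ∸ 2) sqStep (drop (rect l) l))

inA : ℕ → List ℕ → Bool
inA r l = lastCond (iterate (r ∸ 2) sqStep l)
  where
  lastCond : List ℕ → Bool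
  lastCond ρ = null (drop (vrect ρ) ρ) ∧ (if null ρ then true else (part ρ (vrect ρ) ≡ᵇ (vrect ρ ∸ 1)))

-- D_{r,r-1}(n) and A_{r,r-1}(n) as subtypes of lists
-- (T of a Bool is a proposition, so elements are determined by the underlying list)
𝒟 : ℕ → ℕ → Set
𝒟 r n = Σ (List ℕ) (λ l → T (isPartitionOf n l) × T (inD r l))

𝒜 : ℕ → ℕ → Set
𝒜 r n = Σ (List ℕ) (λ l → T (isPartitionOf n l) × T (inA r l))

{-# OPTIONS --safe #-}
-- Cut a partition into its successive Durfee squares, of sides N₁ ≥ N₂ ≥ … ≥ N_k with
-- k = r − 1, and call block j exact if N_j ≥ 1 and its last part is N_j.  Since
-- rect(λ) + 1 = sq(c ∷ λ) for every c ≥ 1, the set 𝒟 consists of the partitions that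
-- are exhausted by k squares and have a block that is not exact.  The bijection takes
-- the lowest such block j, subtracts 1 from each of its N_j parts, and inserts a part
-- N_j right after it (if N_j = 0, nothing changes).  Below block j, every square gains
-- the row above it and gives up its last one, so that a single part N_k is left over at
-- the bottom: this is the last row of the vertical rectangle.  Conversely, j is found
-- as the lowest block whose first part is < N_{j-1} (with N₀ = ∞).
module Submission where

open import Defs
open import Data.Bool using (Bool; true; false; if_then_else_; T)
open import Data.Bool.Properties using (T-∧; T-irrelevant)
open import Data.Empty using (⊥; ⊥-elim)
open import Data.List using (List; []; _∷_; [_]; _++_; _∷ʳ_; length; map; drop; null; initLast; _∷ʳ′_)
open import Data.List.Properties using (length-map; length-++; map-injective; ∷ʳ-++; ∷-injectiveˡ; ∷-injectiveʳ)
open import Data.List.Relation.Unary.All using (All; []; _∷_)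
import Data.List.Relation.Unary.All as All
import Data.List.Relation.Unary.All.Properties as All
open import Data.List.Relation.Unary.AllPairs using (AllPairs; []; _∷_)
import Data.List.Relation.Unary.AllPairs as AllPairs
import Data.List.Relation.Unary.AllPairs.Properties as AllPairs
open import Data.Nat using (ℕ; zero; suc; _+_; _∸_; _≤_; _<_; _≥_; z≤n; s≤s; _≤ᵇ_)
open import Data.Nat.ListAction using (sum)
open import Data.Nat.ListAction.Properties using (sum-++)
open import Data.Nat.Properties
open import Data.Product using (Σ; ∃; _×_; _,_; proj₁; proj₂)
open import Data.Sum using (_⊎_; inj₁; inj₂)
open import Data.Unit using (tt)
open import Function.Bundles using (_⤖_; mk⤖; Equivalence)
open import Relation.Binary.PropositionalEquality using (_≡_; refl; sym; trans; cong; cong₂; subst; module ≡-Reasoning)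
open import Relation.Nullary using (contradiction)

private
  variable
    k c d e n x : ℕ
    s t u v α β ν : List ℕ

Sorted : List ℕ → Set
Sorted = AllPairs _≥_

Partition : List ℕ → Set
Partition l = Sorted l × All (1 ≤_) l

-- Whole rows, including the cells to the right of the rectangle. With `n` equal to `d` and a
-- remainder in `Below d`, these are the rows of the Durfee square.
record Rect (n d : ℕ) (t : List ℕ) : Set where
  constructor rectangle
  field
    rows   : length t ≡ n
    wide   : All (d ≤_) t
    sorted : Sorted t
open Rect

Below : ℕ → List ℕ → Set
Below d = All (_≤ d)

-- Rectangles inside partitions

sorted-++ : All (d ≤_) t → Sorted t → Below d u → Sorted u → Sorted (t ++ u)
sorted-++ wt st bu su =
  AllPairs.++⁺ st su (All.map (λ d≤x → All.map (λ y≤d → ≤-trans y≤d d≤x) bu) wt)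

sorted-∷ʳ⁻ : ∀ s → Sorted (s ∷ʳ x) → Sorted s × All (x ≤_) s
sorted-∷ʳ⁻ []      _        = [] , []
sorted-∷ʳ⁻ (y ∷ s) (p ∷ ps) with sorted-∷ʳ⁻ s ps
... | ss , ws = (All.++⁻ˡ s p ∷ ss) , (All.head (All.++⁻ʳ s p) ∷ ws)

length-∷ʳ : ∀ s → length (s ∷ʳ x) ≡ suc (length s)
length-∷ʳ s = trans (length-++ s) (+-comm (length s) 1)

partition-++ : Rect n (suc d) t → Below (suc d) u → Partition u → Partition (t ++ u)
partition-++ r bu (su , pu) =
  sorted-++ (wide r) (sorted r) bu su , All.++⁺ (All.map (≤-trans (s≤s z≤n)) (wide r)) pu

rect-weaken : Rect n (suc d) t → Rect n d t
rect-weaken (rectangle l w s) = rectangle l (All.map (≤-trans (n≤1+n _)) w) s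

rect-∷ : d ≤ c → Below c t → Rect n d t → Rect (suc n) d (c ∷ t)
rect-∷ d≤c bt (rectangle l w s) = rectangle (cong suc l) (d≤c ∷ w) (bt ∷ s)

rect-∷ʳ : Rect n d t → Rect (suc n) d (t ∷ʳ d)
rect-∷ʳ {t = t} (rectangle l w s) =
  rectangle (trans (length-∷ʳ t) (cong suc l)) (All.++⁺ w (≤-refl ∷ []))
            (sorted-++ w s (≤-refl ∷ []) ([] ∷ []))

rect-tail : Rect (suc n) d (x ∷ t) → Rect n d t
rect-tail (rectangle l (_ ∷ w) (_ ∷ s)) = rectangle (suc-injective l) w s

rect-map-suc : Rect n d t → Rect n (suc d) (map suc t)
rect-map-suc {t = t} (rectangle l w s) =
  rectangle (trans (length-map suc t) l) (All.map⁺ (All.map s≤s w)) (AllPairs.map⁺ (AllPairs.map s≤s s))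

rect-map-suc⁻ : Rect n (suc d) t → ∃ λ t₀ → t ≡ map suc t₀ × Rect n d t₀
rect-map-suc⁻ (rectangle refl [] []) = [] , refl , rectangle refl [] []
rect-map-suc⁻ (rectangle refl (s≤s p ∷ w) (q ∷ s)) with rect-map-suc⁻ (rectangle refl w s)
... | t₀ , refl , r =
  _ , refl , rectangle (cong suc (sym (length-map suc t₀))) (p ∷ wide r)
                       (All.map (λ { (s≤s y) → y }) (All.map⁻ q) ∷ sorted r)

-- The last part is the smallest, so comparing it with `d` decides.
rect-wide-or-exact : Rect (suc n) d t →
                     Rect (suc n) (suc d) t ⊎ ∃ λ s → t ≡ s ∷ʳ d × Rect n d s
rect-wide-or-exact {t = t} r with initLast t
rect-wide-or-exact (rectangle () _ _) | []
rect-wide-or-exact {d = d} (rectangle l w ss) | s ∷ʳ′ y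
  with sorted-∷ʳ⁻ s ss | m≤n⇒m<n∨m≡n (All.head (All.++⁻ʳ s w))
... | s-sorted , y≤s | inj₁ d<y =
  inj₁ (rectangle l (All.++⁺ (All.map (≤-trans d<y) y≤s) (d<y ∷ [])) ss)
... | s-sorted , y≤s | inj₂ refl =
  inj₂ (s , refl , rectangle (suc-injective (trans (sym (length-∷ʳ s)) l)) y≤s s-sorted)

++-split : ∀ t {t′ u u′ : List ℕ} → length t ≡ length t′ → t ++ u ≡ t′ ++ u′ → t ≡ t′ × u ≡ u′
++-split []      {[]}     _ eq = refl , eq
++-split (x ∷ t) {y ∷ t′} l eq with ++-split t {t′} (suc-injective l) (∷-injectiveʳ eq)
... | t≡t′ , u≡u′ = cong₂ _∷_ (∷-injectiveˡ eq) t≡t′ , u≡u′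

drop-++ : ∀ (t : List ℕ) {u} → drop (length t) (t ++ u) ≡ u
drop-++ []      = refl
drop-++ (_ ∷ t) = drop-++ t

-- Durfee squares

maxUpTo-true : ∀ (p : ℕ → Bool) n → T (p (suc n)) → maxUpTo p (suc n) ≡ suc n
maxUpTo-true p n h with p (suc n)
... | true = refl

maxUpTo-hit : ∀ (p : ℕ → Bool) n → (0 < n → T (p n)) → maxUpTo p n ≡ n
maxUpTo-hit p zero    h = refl
maxUpTo-hit p (suc n) h = maxUpTo-true p n (h (s≤s z≤n))

maxUpTo-skip : ∀ (p : ℕ → Bool) n j → (∀ i → n < i → T (p i) → ⊥) → maxUpTo p (j + n) ≡ maxUpTo p n
maxUpTo-skip p n zero    h = refl
maxUpTo-skip p n (suc j) h with p (suc (j + n)) in eq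
... | true  = ⊥-elim (h (suc (j + n)) (s≤s (m≤n+m n j)) (subst T (sym eq) tt))
... | false = maxUpTo-skip p n j h

maxUpTo≤ : ∀ (p : ℕ → Bool) n → maxUpTo p n ≤ n
maxUpTo≤ p zero = z≤n
maxUpTo≤ p (suc n) with p (suc n)
... | true  = ≤-refl
... | false = m≤n⇒m≤1+n (maxUpTo≤ p n)

part-wide : ∀ t → All (d ≤_) t → 0 < length t → d ≤ part (t ++ u) (length t)
part-wide (x ∷ [])    (p ∷ _)  _ = p
part-wide (x ∷ y ∷ t) (_ ∷ ps) _ = part-wide (y ∷ t) ps (s≤s z≤n)

part-below : ∀ t i → Below d u → length t < i → part (t ++ u) i ≤ d
part-below {u = []}    []      i             _        _ = z≤n
part-below {u = _ ∷ _} []      (suc zero)    (p ∷ _)  _ = p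
part-below {u = _ ∷ _} []      (suc (suc i)) (_ ∷ ps) _ = part-below [] (suc i) ps (s≤s z≤n)
part-below             (x ∷ t) (suc (suc i)) bu (s≤s h) = part-below t (suc i) bu h

-- Index `d` passes the test (0 being the default value), and every later row has length at most
-- `d`, which is less than its index.
sq-square : Rect d d t → Below d u → sq (t ++ u) ≡ d
sq-square {t = t} {u = u} (rectangle refl w _) bu = begin
  maxUpTo p (length (t ++ u))     ≡⟨ cong (maxUpTo p) (trans (length-++ t) (+-comm (length t) _)) ⟩
  maxUpTo p (length u + length t) ≡⟨ maxUpTo-skip p (length t) (length u)
                                       (λ i t<i h → <⇒≱ (≤-<-trans (part-below t i bu t<i) t<i) (≤ᵇ⇒≤ i _ h)) ⟩
  maxUpTo p (length t)            ≡⟨ maxUpTo-hit p (length t) (λ 0<t → ≤⇒≤ᵇ (part-wide t w 0<t)) ⟩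
  length t                        ∎
  where
  open ≡-Reasoning
  p : ℕ → Bool
  p i = i ≤ᵇ part (t ++ u) i

sqStep-square : Rect d d t → Below d u → sqStep (t ++ u) ≡ u
sqStep-square {t = t} {u = u} r bu =
  trans (cong (λ i → drop i (t ++ u)) (trans (sq-square r bu) (sym (rows r)))) (drop-++ t)

-- The side is recovered as `sq` of the list, and the splitting from the side. This lets two
-- descriptions of one partition be compared block by block.
square-unique : Rect d d t → Below d u → Rect e e s → Below e v →
                t ++ u ≡ s ++ v → d ≡ e × t ≡ s × u ≡ v
square-unique {t = t} r bu r′ bv eq = d≡e , ++-split t (trans (rows r) (trans d≡e (sym (rows r′)))) eq
  where d≡e = trans (sym (sq-square r bu)) (trans (cong sq eq) (sq-square r′ bv))

data Durfee : List ℕ → Set where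
  empty  : Durfee []
  square : Rect (suc d) (suc d) t → Below (suc d) u → Partition u → Durfee (t ++ u)

-- A new largest part on top either enlarges the square by one, when all its rows are longer than
-- its side, or pushes its last row out into the remainder.
durfee : ∀ l → Partition l → Durfee l
durfee []      _ = empty
durfee (x ∷ l) (x≥l ∷ sl , 1≤x ∷ pl) with durfee l (sl , pl)
... | empty = square {t = [ x ]} {u = []} (rect-∷ 1≤x [] (rectangle refl [] [])) [] ([] , [])
... | square {d = d} {t = t@(_ ∷ _)} {u = u} r bu pu with rect-wide-or-exact r
...   | inj₁ r′ =
  square {t = x ∷ t} (rect-∷ (≤-trans (All.head (wide r′)) (All.head x≥l)) (All.++⁻ˡ t x≥l) r′)
         (All.map m≤n⇒m≤1+n bu) pu
...   | inj₂ (s , eq , r′) =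
  subst (λ z → Durfee (x ∷ z)) (trans (sym (∷ʳ-++ s (suc d) u)) (cong (_++ u) (sym eq)))
    (square {t = x ∷ s} (rect-∷ (≤-trans (All.head (wide r)) (All.head x≥l)) x≥s r′)
            (≤-refl ∷ bu) (bu ∷ proj₁ pu , s≤s z≤n ∷ proj₂ pu))
  where
  x≥s : Below x s
  x≥s = All.++⁻ˡ s (subst (Below x) eq (All.++⁻ˡ t x≥l))

-- The bijection as a relation

-- The last row `suc d` is kept apart from `s` because it is the one that leaves the square when a
-- large enough part is put on top.
data Exact : ℕ → List ℕ → Set where
  []    : Exact 0 []
  block : Rect d (suc d) s → Below (suc d) ν → Exact k ν → Exact (suc k) (s ++ suc d ∷ ν)

-- Shift k α β: with k successive squares, the partition α of 𝒟 corresponds to β of 𝒜.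
data Shift : ℕ → List ℕ → List ℕ → Set where
  nil   : Shift (suc k) [] []
  here  : Rect (suc d) (suc d) t → Below (suc d) ν → Exact k ν →
          Shift (suc k) (map suc t ++ ν) (t ++ suc d ∷ ν)
  there : Rect (suc d) (suc d) t → Below (suc d) α → Shift k α β →
          Shift (suc k) (t ++ α) (t ++ β)

exact-partition : Exact k ν → Partition ν
exact-partition []             = [] , []
exact-partition (block r bν e) with exact-partition e
... | sν , pν = partition-++ r (≤-refl ∷ bν) (bν ∷ sν , s≤s z≤n ∷ pν)

shift-below : Shift k α β → Below c α → Below c β
shift-below nil _ = []
shift-below (here {t = t@(_ ∷ _)} r bν e) b =
  All.++⁺ bt (≤-trans (All.head (wide r)) (All.head bt) ∷ All.++⁻ʳ (map suc t) b)
  where bt = All.map (≤-trans (n≤1+n _)) (All.map⁻ (All.++⁻ˡ (map suc t) b))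
shift-below (there {t = t} r bα h) b = All.++⁺ (All.++⁻ˡ t b) (shift-below h (All.++⁻ʳ t b))

shift-partitionˡ : Shift k α β → Partition α
shift-partitionˡ nil            = [] , []
shift-partitionˡ (here r bν e)  = partition-++ (rect-weaken (rect-map-suc r)) bν (exact-partition e)
shift-partitionˡ (there r bα h) = partition-++ r bα (shift-partitionˡ h)

shift-partitionʳ : Shift k α β → Partition β
shift-partitionʳ nil            = [] , []
shift-partitionʳ (here r bν e)  =
  partition-++ r (≤-refl ∷ bν) (bν ∷ proj₁ (exact-partition e) , s≤s z≤n ∷ proj₂ (exact-partition e))
shift-partitionʳ (there r bα h) = partition-++ r (shift-below h bα) (shift-partitionʳ h)

sum-map-suc : ∀ t → sum (map suc t) ≡ sum t + length t
sum-map-suc []      = refl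
sum-map-suc (x ∷ t) = begin
  suc x + sum (map suc t)      ≡⟨ cong (suc x +_) (sum-map-suc t) ⟩
  suc (x + (sum t + length t)) ≡⟨ cong suc (+-assoc x (sum t) (length t)) ⟨
  suc (x + sum t + length t)   ≡⟨ +-suc (x + sum t) (length t) ⟨
  x + sum t + suc (length t)   ∎
  where open ≡-Reasoning

-- The inserted part has as many cells as there are rows that lose one.
shift-sum : Shift k α β → sum α ≡ sum β
shift-sum nil = refl
shift-sum (here {d = d} {t = t} {ν = ν} r bν e) = begin
  sum (map suc t ++ ν)         ≡⟨ sum-++ (map suc t) ν ⟩
  sum (map suc t) + sum ν      ≡⟨ cong (_+ sum ν) (sum-map-suc t) ⟩
  sum t + length t + sum ν     ≡⟨ cong (λ z → sum t + z + sum ν) (rows r) ⟩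
  sum t + suc d + sum ν        ≡⟨ +-assoc (sum t) (suc d) (sum ν) ⟩
  sum t + (suc d + sum ν)      ≡⟨ sum-++ t (suc d ∷ ν) ⟨
  sum (t ++ suc d ∷ ν)         ∎
  where open ≡-Reasoning
shift-sum (there {t = t} {α = α} {β = β} r bα h) =
  trans (sum-++ t α) (trans (cong (sum t +_) (shift-sum h)) (sym (sum-++ t β)))

-- Each side of the relation determines the other

nonempty-++ : Rect (suc n) d t → t ++ u ≡ [] → ⊥
nonempty-++ {t = _ ∷ _} _ ()

-- The squares agree down to the block that `Shift` alters, but there one description has a last row
-- equal to the side and the other has only longer rows, or none. Hence `here` and `there` cannot
-- both apply to one `α`.
exact-not-shiftˡ : Exact k ν → Shift k α β → ν ≡ α → ⊥
exact-not-shiftˡ [] ()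
exact-not-shiftˡ (block {s = []} _ _ _) nil ()
exact-not-shiftˡ (block {s = _ ∷ _} _ _ _) nil ()
exact-not-shiftˡ (block {d = d} {s = s} r bν e) (here r′ bν′ e′) eq
  with square-unique (rect-∷ʳ r) bν (rect-weaken (rect-map-suc r′)) bν′ (trans (∷ʳ-++ s (suc d) _) eq)
... | refl , st , _ = 1+n≰n (All.head (All.++⁻ʳ s (subst (All (suc (suc d) ≤_)) (sym st) (wide (rect-map-suc r′)))))
exact-not-shiftˡ (block {d = d} {s = s} r bν e) (there r′ bα h) eq
  with square-unique (rect-∷ʳ r) bν r′ bα (trans (∷ʳ-++ s (suc d) _) eq)
... | refl , _ , eq′ = exact-not-shiftˡ e h eq′

-- A block whose first part equals the side of the previous square cannot have been
-- obtained by subtracting 1 from its parts.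
exact-not-shiftʳ : Exact k ν → Below c ν → Shift k α β → Below c α → c ∷ ν ≡ β → ⊥
exact-not-shiftʳ [] _ ()
exact-not-shiftʳ (block _ _ _) _ nil _ ()
exact-not-shiftʳ {c = c} (block {s = s} r bν e) b (here {t = t} r′ bν′ e′) bα eq
  with square-unique (rect-∷ (All.head (All.++⁻ʳ s b)) (All.++⁻ˡ s b) r) (≤-refl ∷ bν) r′ (≤-refl ∷ bν′) eq
... | refl , refl , _ = 1+n≰n (All.head bα)
exact-not-shiftʳ (block {s = s} r bν e) b (there r′ bα h) _ eq
  with square-unique (rect-∷ (All.head (All.++⁻ʳ s b)) (All.++⁻ˡ s b) r) (≤-refl ∷ bν) r′ (shift-below h bα) eq
... | refl , _ , eq′ = exact-not-shiftʳ e bν h bα eq′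

shift-functional : ∀ {α α′ β β′} → Shift k α β → Shift k α′ β′ → α ≡ α′ → β ≡ β′
shift-functional nil nil _ = refl
shift-functional nil (here r _ _)  eq = ⊥-elim (nonempty-++ (rect-map-suc r) (sym eq))
shift-functional nil (there r _ _) eq = ⊥-elim (nonempty-++ r (sym eq))
shift-functional (here r _ _)  nil eq = ⊥-elim (nonempty-++ (rect-map-suc r) eq)
shift-functional (there r _ _) nil eq = ⊥-elim (nonempty-++ r eq)
shift-functional (here r b e) (here r′ b′ e′) eq
  with square-unique (rect-weaken (rect-map-suc r)) b (rect-weaken (rect-map-suc r′)) b′ eq
... | refl , tt′ , νν′ = cong₂ (λ t ν → t ++ _ ∷ ν) (map-injective suc-injective tt′) νν′
shift-functional (here r b e) (there r′ b′ h′) eq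
  with square-unique (rect-weaken (rect-map-suc r)) b r′ b′ eq
... | refl , _ , eq′ = ⊥-elim (exact-not-shiftˡ e h′ eq′)
shift-functional (there r b h) (here r′ b′ e′) eq
  with square-unique r b (rect-weaken (rect-map-suc r′)) b′ eq
... | refl , _ , eq′ = ⊥-elim (exact-not-shiftˡ e′ h (sym eq′))
shift-functional (there r b h) (there r′ b′ h′) eq with square-unique r b r′ b′ eq
... | refl , tt′ , eq′ = cong₂ _++_ tt′ (shift-functional h h′ eq′)

-- The altered block keeps its side, as its rows drop from at least `suc (suc d)` to at least
-- `suc d`; so the squares of `β` can be compared in the same way.
shift-injective : ∀ {α α′ β β′} → Shift k α β → Shift k α′ β′ → β ≡ β′ → α ≡ α′
shift-injective nil nil _ = refl
shift-injective nil (here r _ _)  eq = ⊥-elim (nonempty-++ r (sym eq))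
shift-injective nil (there r _ _) eq = ⊥-elim (nonempty-++ r (sym eq))
shift-injective (here r _ _)  nil eq = ⊥-elim (nonempty-++ r eq)
shift-injective (there r _ _) nil eq = ⊥-elim (nonempty-++ r eq)
shift-injective (here r b e) (here r′ b′ e′) eq
  with square-unique r (≤-refl ∷ b) r′ (≤-refl ∷ b′) eq
... | refl , refl , refl = refl
shift-injective (here r b e) (there r′ b′ h′) eq
  with square-unique r (≤-refl ∷ b) r′ (shift-below h′ b′) eq
... | refl , _ , eq′ = ⊥-elim (exact-not-shiftʳ e b h′ b′ eq′)
shift-injective (there r b h) (here r′ b′ e′) eq
  with square-unique r (shift-below h b) r′ (≤-refl ∷ b′) eq
... | refl , _ , eq′ = ⊥-elim (exact-not-shiftʳ e′ b′ h b (sym eq′))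
shift-injective (there r b h) (there r′ b′ h′) eq
  with square-unique r (shift-below h b) r′ (shift-below h′ b′) eq
... | refl , tt′ , eq′ = cong₂ _++_ tt′ (shift-injective h h′ eq′)

-- The domain of the relation is 𝒟

iterate-sqStep-[] : ∀ k → iterate k sqStep [] ≡ []
iterate-sqStep-[] zero    = refl
iterate-sqStep-[] (suc k) = iterate-sqStep-[] k

iterate-square : ∀ k → Rect d d t → Below d u → iterate (suc k) sqStep (t ++ u) ≡ iterate k sqStep u
iterate-square k r b = cong (iterate k sqStep) (sqStep-square r b)

exact-exhausted : Exact k ν → iterate k sqStep ν ≡ []
exact-exhausted [] = refl
exact-exhausted (block {d = d} {s = s} {ν = ν} {k = k} r b e) =
  trans (cong (iterate (suc k) sqStep) (sym (∷ʳ-++ s (suc d) ν)))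
        (trans (iterate-square k (rect-∷ʳ r) b) (exact-exhausted e))

shift-exhausted : Shift k α β → iterate k sqStep α ≡ []
shift-exhausted {k = suc k} nil           = iterate-sqStep-[] k
shift-exhausted {k = suc k} (here r b e)  =
  trans (iterate-square k (rect-weaken (rect-map-suc r)) b) (exact-exhausted e)
shift-exhausted {k = suc k} (there r b h) = trans (iterate-square k r b) (shift-exhausted h)

-- The remainder is settled first, so a block is examined only when all those below it are exact;
-- this finds the lowest one that is not. An empty block counts as not exact.
exhausted-dichotomy : ∀ k → Partition ν → iterate k sqStep ν ≡ [] → Exact k ν ⊎ ∃ (Shift k ν)
exhausted-dichotomy zero    p refl = inj₁ []
exhausted-dichotomy {ν} (suc k) p eq with durfee ν p
... | empty = inj₂ ([] , nil)
... | square {d = d} {t = t} {u = u} r b pu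
  with exhausted-dichotomy k pu (trans (sym (iterate-square k r b)) eq)
...   | inj₂ (β , h) = inj₂ (t ++ β , there r b h)
...   | inj₁ e with rect-wide-or-exact r
...     | inj₂ (s , refl , r′) = inj₁ (subst (Exact (suc k)) (sym (∷ʳ-++ s (suc d) u)) (block r′ b e))
...     | inj₁ r′ with rect-map-suc⁻ r′
...       | t₀ , refl , r₀ = inj₂ (_ , here r₀ b e)

-- A block whose rows all exceed its side absorbs the added part and leaves the rest untouched; an
-- exact block absorbs it and hands its last row down. Were all `k` blocks exact, one part would
-- remain at the end.
exhausted⇒shift : ∀ k → Partition α → Below (suc c) α → iterate k sqStep (suc c ∷ α) ≡ [] → ∃ (Shift k α)
exhausted⇒shift zero    p b ()
exhausted⇒shift {α} {c} (suc k) p b eq with durfee α p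
... | empty = [] , nil
... | square {d = d} {t = t@(_ ∷ _)} {u = u} r bu pu with rect-wide-or-exact r
...   | inj₁ r′ = loose (exhausted-dichotomy k pu (trans (sym (iterate-square k r″ (All.map m≤n⇒m≤1+n bu))) eq))
  where
  r″ : Rect (suc (suc d)) (suc (suc d)) (suc c ∷ t)
  r″ = rect-∷ (≤-trans (All.head (wide r′)) (All.head b)) (All.++⁻ˡ t b) r′
  loose : Exact k u ⊎ ∃ (Shift k u) → ∃ (Shift (suc k) (t ++ u))
  loose (inj₂ (β , h)) = t ++ β , there r bu h
  loose (inj₁ e) with rect-map-suc⁻ r′
  ... | t₀ , eq₀ , r₀ = _ , subst (λ z → Shift (suc k) (z ++ u) (t₀ ++ suc d ∷ u)) (sym eq₀) (here r₀ bu e)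
-- The released row `suc d` heads the remainder and becomes the added part of the recursive call.
...   | inj₂ (s , eq₀ , r′) = t ++ proj₁ rest , there r bu (proj₂ rest)
  where
  r″ : Rect (suc d) (suc d) (suc c ∷ s)
  r″ = rect-∷ (≤-trans (All.head (wide r)) (All.head b)) (All.++⁻ˡ s (subst (Below (suc c)) eq₀ (All.++⁻ˡ t b))) r′
  t++u : t ++ u ≡ s ++ suc d ∷ u
  t++u = trans (cong (_++ u) eq₀) (∷ʳ-++ s (suc d) u)
  rest : ∃ (Shift k u)
  rest = exhausted⇒shift k pu bu
    (trans (sym (iterate-square k r″ (≤-refl ∷ bu)))
           (trans (cong (λ z → iterate (suc k) sqStep (suc c ∷ z)) (sym t++u)) eq))

shift⇒exhausted : Shift k α β → Below (suc c) α → iterate k sqStep (suc c ∷ α) ≡ []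
shift⇒exhausted {k = suc k} nil _ = iterate-sqStep-[] k
shift⇒exhausted {k = suc k} (here {t = t@(_ ∷ _)} r bν e) b =
  trans (iterate-square k (rect-∷ (≤-trans (All.head (wide (rect-map-suc r))) (All.head b))
                                  (All.++⁻ˡ (map suc t) b) (rect-map-suc r))
                          (All.map m≤n⇒m≤1+n bν))
        (exact-exhausted e)
shift⇒exhausted {k = suc k} {c = c} (there {d = d} {t = t@(_ ∷ _)} {α = α} r bα h) b with rect-wide-or-exact r
... | inj₁ r′ =
  trans (iterate-square k (rect-∷ (≤-trans (All.head (wide r′)) (All.head b)) (All.++⁻ˡ t b) r′)
                          (All.map m≤n⇒m≤1+n bα))
        (shift-exhausted h)
... | inj₂ (s , eq₀ , r′) =
  trans (cong (λ z → iterate (suc k) sqStep (suc c ∷ z)) (trans (cong (_++ α) eq₀) (∷ʳ-++ s (suc d) α)))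
        (trans (iterate-square k (rect-∷ (≤-trans (All.head (wide r)) (All.head b))
                                         (All.++⁻ˡ s (subst (Below (suc c)) eq₀ (All.++⁻ˡ t b))) r′)
                                 (≤-refl ∷ bα))
               (shift⇒exhausted h bα))

maxUpTo-suc : ∀ (p q : ℕ → Bool) → T (p 1) → (∀ i → p (suc (suc i)) ≡ q (suc i)) →
              ∀ n → maxUpTo p (suc n) ≡ suc (maxUpTo q n)
maxUpTo-suc p q p1 pq zero = maxUpTo-true p 0 p1
maxUpTo-suc p q p1 pq (suc n) with p (suc (suc n)) | q (suc n) | pq n
... | true  | _ | refl = refl
... | false | _ | refl = maxUpTo-suc p q p1 pq n

-- Part `i` of `l` is part `i + 1` of the longer list, which turns the test of `rect` into that of
-- `sq`. The added part is positive, so index 1 passes, and it is itself the extra row dropped.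
rect-as-sq : ∀ c l → drop (rect l) l ≡ sqStep (suc c ∷ l)
rect-as-sq c l = cong (λ i → drop i (suc c ∷ l))
  (sym (maxUpTo-suc (λ i → i ≤ᵇ part (suc c ∷ l) i) (λ i → suc i ≤ᵇ part l i) tt (λ _ → refl) (length l)))

null⇒≡[] : ∀ l → T (null {A = ℕ} l) → l ≡ []
null⇒≡[] [] _ = refl

inD⇒shift : ∀ k → Partition α → Below (suc c) α → T (inD (2 + k) α) → ∃ (Shift (suc k) α)
inD⇒shift {α} {c} k p b h =
  exhausted⇒shift (suc k) p b
    (trans (cong (iterate k sqStep) (sym (rect-as-sq c α))) (null⇒≡[] _ h))

shift⇒inD : ∀ k → Shift (suc k) α β → Below (suc c) α → T (inD (2 + k) α)
shift⇒inD {α} {c = c} k h b =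
  subst (λ z → T (null z))
    (sym (trans (cong (iterate k sqStep) (rect-as-sq c α)) (shift⇒exhausted h b))) tt

-- The codomain of the relation is 𝒜

-- After k squares there remains one part, equal to the side of the last square (to c
-- if k = 0), or the partition is exhausted earlier.
data Leftover : ℕ → ℕ → List ℕ → Set where
  last : Leftover 0 c [ c ]
  nil  : Leftover (suc k) c []
  step : Rect (suc d) (suc d) t → Below (suc d) β → Leftover k (suc d) β → Leftover (suc k) c (t ++ β)

-- Each square takes in the row above it and releases its last one to the next; the final released
-- row is left over.
exact⇒leftover : Exact k ν → Below c ν → Leftover k c (c ∷ ν)
exact⇒leftover [] _ = last
exact⇒leftover (block {s = s} r bν e) b =
  step (rect-∷ (All.head (All.++⁻ʳ s b)) (All.++⁻ˡ s b) r) (≤-refl ∷ bν) (exact⇒leftover e bν)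

shift⇒leftover : Shift k α β → Leftover k c β
shift⇒leftover nil            = nil
shift⇒leftover (here r bν e)  = step r (≤-refl ∷ bν) (exact⇒leftover e bν)
shift⇒leftover (there r bα h) = step r (shift-below h bα) (shift⇒leftover h)

-- This undoes the shift from the bottom up. In the first alternative every block so far may have
-- received its first row from above; in the second the altered block has been found.
leftover-dichotomy : Leftover k c β → Below c β →
                     (∃ λ ν → β ≡ c ∷ ν × Below c ν × Exact k ν) ⊎ (∃ λ α → Shift k α β × Below c α)
leftover-dichotomy last b = inj₁ ([] , refl , [] , [])
leftover-dichotomy nil  b = inj₂ ([] , nil , [])
leftover-dichotomy {c = c} (step {d = d} {t = t@(x ∷ t′)} r bβ l) b with leftover-dichotomy l bβ
... | inj₂ (α , h , bα) =
  inj₂ (t ++ α , there r bα h ,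
        All.++⁺ (All.++⁻ˡ t b) (All.map (λ y≤d → ≤-trans y≤d (≤-trans (All.head (wide r)) (All.head b))) bα))
... | inj₁ (ν , refl , bν , e) with m≤n⇒m<n∨m≡n (All.head b) | sorted r
-- The first row `c` is returned to the block above, and the row `suc d` comes back from below to
-- close an exact block.
...   | inj₂ refl | _ = inj₁ (t′ ++ suc d ∷ ν , refl , All.tail b , block (rect-tail r) bν e)
-- The first row is shorter than `c`, so all rows can grow by 1 within the bound.
...   | inj₁ x<c  | x≥t′ ∷ _ =
  inj₂ (map suc t ++ ν , here r bν e ,
        All.++⁺ (All.map⁺ (x<c ∷ All.map (λ y≤x → ≤-trans (s≤s y≤x) x<c) x≥t′))
                (All.tail (All.++⁻ʳ t b)))

leftover⇒shift : Leftover (suc k) c β → Below n β → ∃ λ α → Shift (suc k) α β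
-- No part reaches `suc n`, which serves as the infinite side above the first block and rules out
-- the first alternative.
leftover⇒shift {k = k} {n = n} l b with leftover-dichotomy {c = suc n} (recap l) (All.map m≤n⇒m≤1+n b)
  where
  recap : ∀ {c c′ β} → Leftover (suc k) c β → Leftover (suc k) c′ β
  recap nil          = nil
  recap (step r b l) = step r b l
... | inj₂ (α , h , _)       = α , h
... | inj₁ (ν , refl , _) = ⊥-elim (1+n≰n (All.head b))

-- The vertical rectangle at the bottom

drop-null⇒length≤ : ∀ i (l : List ℕ) → T (null (drop i l)) → length l ≤ i
drop-null⇒length≤ zero    []      _ = z≤n
drop-null⇒length≤ (suc i) []      _ = z≤n
drop-null⇒length≤ (suc i) (x ∷ l) h = s≤s (drop-null⇒length≤ i l h)

part-∷ʳ : ∀ s → part (s ∷ʳ x) (suc (length s)) ≡ x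
part-∷ʳ []          = refl
part-∷ʳ (_ ∷ [])    = refl
part-∷ʳ (_ ∷ y ∷ s) = part-∷ʳ (y ∷ s)

null-drop-length : ∀ (l : List ℕ) → T (null (drop (length l) l))
null-drop-length []      = tt
null-drop-length (_ ∷ l) = null-drop-length l

if-null-∷ʳ : ∀ s {b : Bool} → (if null (s ∷ʳ x) then true else b) ≡ b
if-null-∷ʳ []      = refl
if-null-∷ʳ (_ ∷ _) = refl

-- If nothing lies below the rectangle, its height is the number of parts. Condition (b) makes the
-- last part one less, so the rows before it form a square.
inA₂⇒leftover : ∀ β → Partition β → T (inA 2 β) → Leftover 1 c β
inA₂⇒leftover β p h with initLast β
... | [] = nil
... | s ∷ʳ′ x = go x p x≡
  where
  h₁ : T (null (drop (vrect (s ∷ʳ x)) (s ∷ʳ x)))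
  h₁ = proj₁ (Equivalence.to T-∧ h)
  vrect≡ : vrect (s ∷ʳ x) ≡ suc (length s)
  vrect≡ = trans (≤-antisym (maxUpTo≤ _ _) (drop-null⇒length≤ _ _ h₁)) (length-∷ʳ s)
  x≡ : x ≡ length s
  x≡ = trans (sym (part-∷ʳ s))
         (subst (λ v → part (s ∷ʳ x) v ≡ v ∸ 1) vrect≡
           (≡ᵇ⇒≡ _ _ (subst T (if-null-∷ʳ s) (proj₂ (Equivalence.to (T-∧ {null (drop (vrect (s ∷ʳ x)) (s ∷ʳ x))}) h)))))
  go : ∀ x → Partition (s ∷ʳ x) → x ≡ length s → Leftover 1 _ (s ∷ʳ x)
  go zero    (_ , p)  _  = contradiction (All.head (All.++⁻ʳ s p)) λ ()
  go (suc d) (ss , _) eq with sorted-∷ʳ⁻ s ss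
  ... | s-sorted , w = step (rectangle (sym eq) w s-sorted) (≤-refl ∷ []) last

leftover⇒inA₂ : Leftover 1 c β → T (inA 2 β)
leftover⇒inA₂ nil = tt
leftover⇒inA₂ (step {d = d} {t = t} r b last) =
  Equivalence.from T-∧
    ( subst (λ v → T (null (drop v l))) (sym vrect≡length) (null-drop-length l)
    , subst T (sym (if-null-∷ʳ t))
        (≡⇒≡ᵇ _ _ (subst (λ v → part l v ≡ v ∸ 1) (sym vrect≡) (trans (part-∷ʳ t) (sym (rows r))))))
  where
  l = t ∷ʳ suc d
  p : ℕ → Bool
  p i = (i ∸ 1) ≤ᵇ part l i
  vrect≡ : vrect l ≡ suc (length t)
  vrect≡ = trans (cong (maxUpTo p) (length-∷ʳ t))
    -- The full height qualifies: the last part `suc d` is the number of rows of `t`, one less than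
    -- the height.
    (maxUpTo-true p (length t) (≤⇒≤ᵇ (≤-reflexive (trans (rows r) (sym (part-∷ʳ t))))))
  vrect≡length : vrect l ≡ length l
  vrect≡length = trans vrect≡ (sym (length-∷ʳ t))

inA-[] : ∀ k → T (inA (2 + k) [])
inA-[] zero    = tt
inA-[] (suc k) = inA-[] k

inA⇒leftover : ∀ k → Partition β → T (inA (2 + k) β) → Leftover (suc k) c β
inA⇒leftover {β} zero    p h = inA₂⇒leftover β p h
inA⇒leftover {β} (suc k) p h with durfee β p
... | empty         = nil
... | square r b pu = step r b (inA⇒leftover k pu (subst (λ z → T (inA (2 + k) z)) (sqStep-square r b) h))

leftover⇒inA : ∀ k → Leftover (suc k) c β → T (inA (2 + k) β)
leftover⇒inA zero    l            = leftover⇒inA₂ l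
leftover⇒inA (suc k) nil          = inA-[] k
leftover⇒inA (suc k) (step r b l) =
  subst (λ z → T (inA (2 + k) z)) (sym (sqStep-square r b)) (leftover⇒inA k l)

-- Boolean tests for partitions

positive⇒All : ∀ l → T (positive l) → All (1 ≤_) l
positive⇒All []          _ = []
positive⇒All (suc x ∷ l) h = s≤s z≤n ∷ positive⇒All l h

All⇒positive : ∀ {l} → All (1 ≤_) l → T (positive l)
All⇒positive []            = tt
All⇒positive (s≤s _ ∷ p) = All⇒positive p

nonIncreasing⇒Sorted : ∀ l → T (nonIncreasing l) → Sorted l
nonIncreasing⇒Sorted []          _ = []
nonIncreasing⇒Sorted (x ∷ [])    _ = [] ∷ []
nonIncreasing⇒Sorted (x ∷ y ∷ l) h
  with ≤ᵇ⇒≤ y x (proj₁ (Equivalence.to T-∧ h))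
     | nonIncreasing⇒Sorted (y ∷ l) (proj₂ (Equivalence.to (T-∧ {y ≤ᵇ x}) h))
... | y≤x | q ∷ qs = (y≤x ∷ All.map (λ z≤y → ≤-trans z≤y y≤x) q) ∷ q ∷ qs

Sorted⇒nonIncreasing : ∀ {l} → Sorted l → T (nonIncreasing l)
Sorted⇒nonIncreasing []                 = tt
Sorted⇒nonIncreasing ([] ∷ [])          = tt
Sorted⇒nonIncreasing ((p ∷ _) ∷ q ∷ qs) = Equivalence.from T-∧ (≤⇒≤ᵇ p , Sorted⇒nonIncreasing (q ∷ qs))

isPartitionOf⇒ : ∀ l → T (isPartitionOf n l) → Partition l × sum l ≡ n
isPartitionOf⇒ l h with Equivalence.to (T-∧ {positive l}) h
... | p , h′ with Equivalence.to (T-∧ {nonIncreasing l}) h′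
...   | s , q = (nonIncreasing⇒Sorted l s , positive⇒All l p) , ≡ᵇ⇒≡ _ _ q

⇒isPartitionOf : ∀ {l} → Partition l → sum l ≡ n → T (isPartitionOf n l)
⇒isPartitionOf (s , p) q =
  Equivalence.from T-∧ (All⇒positive p , Equivalence.from T-∧ (Sorted⇒nonIncreasing s , ≡⇒≡ᵇ _ _ q))

-- Assembling the bijection

below-sum : ∀ l → Below (sum l) l
below-sum []      = []
below-sum (x ∷ l) = m≤m+n x (sum l) ∷ All.map (λ y≤ → ≤-trans y≤ (m≤n+m (sum l) x)) (below-sum l)

-- A crude positive bound on all parts, which supplies the part put on top of a member of `𝒟`.
below-suc-sum : ∀ l → Below (suc (sum l)) l
below-suc-sum l = All.map m≤n⇒m≤1+n (below-sum l)

𝒟⇒shift : ∀ k → ((l , _) : 𝒟 (2 + k) n) → ∃ (Shift (suc k) l)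
𝒟⇒shift k (l , p , h) = inD⇒shift k (proj₁ (isPartitionOf⇒ l p)) (below-suc-sum l) h

𝒜⇒shift : ∀ k → ((l , _) : 𝒜 (2 + k) n) → ∃ λ α → Shift (suc k) α l
𝒜⇒shift k (l , p , h) = leftover⇒shift {c = 0} (inA⇒leftover k (proj₁ (isPartitionOf⇒ l p)) h) (below-sum l)

subtype-≡ : ∀ {p q : List ℕ → Bool} {x y : Σ (List ℕ) (λ l → T (p l) × T (q l))} → proj₁ x ≡ proj₁ y → x ≡ y
subtype-≡ {x = _ , _ , _} {y = _ , _ , _} refl =
  cong₂ (λ a b → _ , a , b) (T-irrelevant _ _) (T-irrelevant _ _)

theorem6p1 : (r n : ℕ) → 2 ≤ r → 𝒟 r n ⤖ 𝒜 r n
theorem6p1 (suc (suc k)) n (s≤s (s≤s z≤n)) = mk⤖ (injective , surjective)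
  where
  to : 𝒟 (2 + k) n → 𝒜 (2 + k) n
  to x@(l , p , _) with 𝒟⇒shift k x
  ... | β , h = β
    , ⇒isPartitionOf (shift-partitionʳ h) (trans (sym (shift-sum h)) (proj₂ (isPartitionOf⇒ l p)))
    , leftover⇒inA {c = 0} k (shift⇒leftover h)

  to-shift : ∀ x → Shift (suc k) (proj₁ x) (proj₁ (to x))
  to-shift x = proj₂ (𝒟⇒shift k x)

  injective : ∀ {x y} → to x ≡ to y → x ≡ y
  injective {x} {y} eq = subtype-≡ (shift-injective (to-shift x) (to-shift y) (cong proj₁ eq))

  surjective : ∀ y → ∃ λ x → ∀ {z} → z ≡ x → to z ≡ y
  surjective y@(l , p , _) with 𝒜⇒shift k y
  -- `to` computes its own partner of `α`; functionality of the relation identifies it with `l`.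
  ... | α , h = preimage , λ { refl → subtype-≡ (shift-functional (to-shift preimage) h refl) }
    where
    preimage : 𝒟 (2 + k) n
    preimage = α , ⇒isPartitionOf (shift-partitionˡ h) (trans (shift-sum h) (proj₂ (isPartitionOf⇒ l p)))
                 , shift⇒inD k h (below-suc-sum α)
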